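{- Let $G$ be a (finite) maximal triangle-free graph which does not contain the Mycielski–Grötzsch graph $\Upsilon$ as a subgraph and which satisfies property $\mathscr{D}_3$. Then $G$ is a blow-up of some Andrásfai graph $\Gamma_k$.
   Context: A graph is maximal triangle-free if it contains no triangle but adding any new edge between two non-adjacent vertices creates a triangle. A blow-up of $H$ is any graph obtained by replacing each vertex of $H$ by a non-empty independent set and each edge of $H$ by the complete bipartite graph between the corresponding sets, with no further edges. Property $\mathscr{D}_k$: for every $m\in\{1,\dots,k\}$ and every sequence $x_1,\dots,x_{3m}$ of (not necessarily distinct) vertices there is a vertex $y$ with $|\{i\in[3m]: x_iy\in E(G)\}|\ge m+1$. Andrásfai graph $\Gamma_k$ ($k\ge1$): vertex set $\mathbb Z/(3k-1)\mathbb Z$, $ij$ an edge iff $i-j\in\{k,\dots,2k-1\}$ mod $3k-1$. Mycielski–Grötzsch graph $\Upsilon$: vertices $a_j,b_j$ ($j\in\mathbb Z/5\mathbb Z$) and $c$; its 20 edges are all pairs $a_jc$, $a_jb_{j+2}$, $a_jb_{j-2}$, $b_jb_{j+2}$. -}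

module Defs where

open import Data.Nat using (ℕ; zero; suc; _+_; _*_; _∸_; _≤_; _<_; NonZero)
open import Data.Nat.Properties
open import Data.Nat.DivMod using (_%_; _mod_; m%n<n; m<n⇒m%n≡m; [m+n]%n≡m%n)
open import Data.Fin using (Fin; toℕ)
open import Data.Fin.Patterns using (0F; 1F; 2F; 3F; 4F)
open import Data.Fin.Properties using (toℕ<n; toℕ-fromℕ<; toℕ-injective; nonZeroIndex)
open import Data.Vec using (Vec; count)
open import Data.Product using (∃-syntax; _×_; _,_)
open import Data.Sum using (_⊎_; inj₁; inj₂)
open import Function.Definitions using (Injective; StrictlySurjective)
open import Level using (0ℓ)
open import Relation.Binary.Core using (Rel)
open import Relation.Binary.Definitions
  using (Symmetric; Irreflexive; Decidable; tri<; tri≈; tri>)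
open import Relation.Binary.Construct.Closure.Symmetric using (SymClosure; fwd; bwd; symmetric)
open import Relation.Binary.PropositionalEquality
open import Relation.Nullary using (¬_; contradiction)

record Graph (V : Set) : Set₁ where
  field
    Adj        : Rel V 0ℓ
    Adj-sym    : Symmetric Adj
    Adj-irrefl : Irreflexive _≡_ Adj

open Graph public

private variable
  V W : Set

HasTriangle : Graph V → Set
HasTriangle G = ∃[ x ] ∃[ y ] ∃[ z ] Adj G x y × Adj G y z × Adj G x z

addEdge : (G : Graph V) (u v : V) → u ≢ v → Graph V
addEdge G u v u≢v = record
  { Adj        = λ x y → Adj G x y ⊎ (x ≡ u × y ≡ v) ⊎ (x ≡ v × y ≡ u)
  ; Adj-sym    = λ { (inj₁ e)              → inj₁ (Adj-sym G e)
                   ; (inj₂ (inj₁ (p , q))) → inj₂ (inj₂ (q , p))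
                   ; (inj₂ (inj₂ (p , q))) → inj₂ (inj₁ (q , p)) }
  ; Adj-irrefl = λ { x≡y (inj₁ e)              → Adj-irrefl G x≡y e
                   ; x≡y (inj₂ (inj₁ (p , q))) → u≢v (trans (sym p) (trans x≡y q))
                   ; x≡y (inj₂ (inj₂ (p , q))) → u≢v (trans (sym q) (trans (sym x≡y) p)) }
  }

MaximalTriangleFree : Graph V → Set
MaximalTriangleFree G =
  ¬ HasTriangle G ×
  (∀ u v (u≢v : u ≢ v) → ¬ Adj G u v → HasTriangle (addEdge G u v u≢v))

-- H is a (not necessarily induced) subgraph of G, up to isomorphism.
_⊑_ : Graph W → Graph V → Set
H ⊑ G = ∃[ f ] Injective _≡_ _≡_ f × (∀ {x y} → Adj H x y → Adj G (f x) (f y))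

-- The vertices of G are partitioned into the sets { v | part v ≡ w }, one for
-- each vertex w of H.
record IsBlowUpOf (G : Graph V) (H : Graph W) : Set where
  field
    part        : V → W
    nonEmpty    : StrictlySurjective _≡_ part
    independent : ∀ {x y} → part x ≡ part y → ¬ Adj G x y
    complete    : ∀ {x y} → Adj H (part x) (part y) → Adj G x y
    noFurther   : ∀ {x y} → Adj G x y → Adj H (part x) (part y)

-- count runs over positions in the sequence, so repeated vertices are counted
-- with multiplicity.
PropertyD : ∀ {n} (G : Graph (Fin n)) → Decidable (Adj G) → ℕ → Set
PropertyD {n} G adj? k =
  ∀ m → 1 ≤ m → m ≤ k → (xs : Vec (Fin n) (3 * m)) →
  ∃[ y ] m + 1 ≤ count (λ x → adj? x y) xs

-- Arithmetic of ℤ/nℤ on Fin n; n ∸ toℕ j represents −j.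
infixl 6 _⊕_ _⊖_

_⊕_ _⊖_ : ∀ {n} → Fin n → Fin n → Fin n
_⊕_ {n} i j = ((toℕ i + toℕ j) mod n) {{nonZeroIndex i}}
_⊖_ {n} i j = ((toℕ i + (n ∸ toℕ j)) mod n) {{nonZeroIndex i}}

module _ {n} (i j : Fin n) where
  private instance
    n≢0 : NonZero n
    n≢0 = nonZeroIndex i

  toℕ-⊖ : toℕ (i ⊖ j) ≡ (toℕ i + (n ∸ toℕ j)) % n
  toℕ-⊖ = toℕ-fromℕ< (m%n<n (toℕ i + (n ∸ toℕ j)) n)

  toℕ-⊖-≥ : toℕ j ≤ toℕ i → toℕ (i ⊖ j) ≡ toℕ i ∸ toℕ j
  toℕ-⊖-≥ j≤i = begin
    toℕ (i ⊖ j)                    ≡⟨ toℕ-⊖ ⟩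
    (toℕ i + (n ∸ toℕ j)) % n      ≡⟨ cong (_% n) (+-∸-assoc (toℕ i) (<⇒≤ (toℕ<n j))) ⟨
    (toℕ i + n ∸ toℕ j) % n        ≡⟨ cong (_% n) (+-∸-comm n j≤i) ⟩
    (toℕ i ∸ toℕ j + n) % n        ≡⟨ [m+n]%n≡m%n (toℕ i ∸ toℕ j) n ⟩
    (toℕ i ∸ toℕ j) % n            ≡⟨ m<n⇒m%n≡m (≤-<-trans (m∸n≤m (toℕ i) (toℕ j)) (toℕ<n i)) ⟩
    toℕ i ∸ toℕ j                  ∎
    where open ≡-Reasoning

  toℕ-⊖-< : toℕ i < toℕ j → toℕ (i ⊖ j) ≡ n ∸ (toℕ j ∸ toℕ i)
  toℕ-⊖-< i<j = begin
    toℕ (i ⊖ j)                    ≡⟨ toℕ-⊖ ⟩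
    (toℕ i + (n ∸ toℕ j)) % n      ≡⟨ m<n⇒m%n≡m i+[n∸j]<n ⟩
    toℕ i + (n ∸ toℕ j)            ≡⟨ +-∸-assoc (toℕ i) j≤n ⟨
    toℕ i + n ∸ toℕ j              ≡⟨ cong₂ _∸_ (+-comm (toℕ i) n) (sym (m∸n+n≡m (<⇒≤ i<j))) ⟩
    n + toℕ i ∸ (toℕ j ∸ toℕ i + toℕ i)  ≡⟨ [m+n]∸[o+n]≡m∸o n (toℕ j ∸ toℕ i) (toℕ i) ⟩
    n ∸ (toℕ j ∸ toℕ i)            ∎
    where
    open ≡-Reasoning
    j≤n = <⇒≤ (toℕ<n j)
    [m+n]∸[o+n]≡m∸o : ∀ m o p → m + p ∸ (o + p) ≡ m ∸ o
    [m+n]∸[o+n]≡m∸o m o p rewrite +-comm m p | +-comm o p = [m+n]∸[m+o]≡n∸o p m o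
    i+[n∸j]<n : toℕ i + (n ∸ toℕ j) < n
    i+[n∸j]<n = subst (toℕ i + (n ∸ toℕ j) <_) (m+[n∸m]≡n j≤n) (+-monoˡ-< (n ∸ toℕ j) i<j)

⊖-self : ∀ {n} (i : Fin n) → toℕ (i ⊖ i) ≡ 0
⊖-self i = trans (toℕ-⊖-≥ i i ≤-refl) (n∸n≡0 (toℕ i))

⊖-swap : ∀ {n} (i j : Fin n) → i ≢ j → toℕ (j ⊖ i) ≡ n ∸ toℕ (i ⊖ j)
⊖-swap {n} i j i≢j with <-cmp (toℕ i) (toℕ j)
... | tri< i<j _ _ rewrite toℕ-⊖-< i j i<j | toℕ-⊖-≥ j i (<⇒≤ i<j) =
  sym
    (m∸[m∸n]≡n (≤-trans (m∸n≤m (toℕ j) (toℕ i)) (<⇒≤ (toℕ<n j))))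
... | tri≈ _ i≡j _ = contradiction (toℕ-injective i≡j) i≢j
... | tri> _ _ j<i rewrite toℕ-⊖-≥ i j (<⇒≤ j<i) | toℕ-⊖-< j i j<i = refl

Γ : (k : ℕ) → Graph (Fin (3 * k ∸ 1))
Γ k = record
  { Adj        = λ i j → k ≤ toℕ (i ⊖ j) × toℕ (i ⊖ j) ≤ 2 * k ∸ 1
  ; Adj-sym    = λ {i} {j} → symm k i j
  ; Adj-irrefl = λ { {i} refl (k≤d , _) → irr k i k≤d }
  }
  where
  irr : ∀ k (i : Fin (3 * k ∸ 1)) → ¬ k ≤ toℕ (i ⊖ i)
  irr (suc k) i k≤d with () ← subst (suc k ≤_) (⊖-self i) k≤d

  symm : ∀ k (i j : Fin (3 * k ∸ 1)) →
         k ≤ toℕ (i ⊖ j) × toℕ (i ⊖ j) ≤ 2 * k ∸ 1 →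
         k ≤ toℕ (j ⊖ i) × toℕ (j ⊖ i) ≤ 2 * k ∸ 1
  symm k@(suc k-1) i j (k≤d , d≤l) = lower , upper
    where
    n = 3 * k ∸ 1
    l = 2 * k ∸ 1
    d = toℕ (i ⊖ j)

    n≡k+l : n ≡ k + l
    n≡k+l = +-suc k-1 l

    i≢j : i ≢ j
    i≢j refl = irr k i k≤d

    open ≤-Reasoning

    lower : k ≤ toℕ (j ⊖ i)
    lower = begin
      k             ≡⟨ m+n∸n≡m k l ⟨
      k + l ∸ l     ≡⟨ cong (_∸ l) n≡k+l ⟨
      n ∸ l         ≤⟨ ∸-monoʳ-≤ n d≤l ⟩
      n ∸ d         ≡⟨ ⊖-swap i j i≢j ⟨
      toℕ (j ⊖ i)   ∎

    upper : toℕ (j ⊖ i) ≤ l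
    upper = begin
      toℕ (j ⊖ i)   ≡⟨ ⊖-swap i j i≢j ⟩
      n ∸ d         ≤⟨ ∸-monoʳ-≤ n k≤d ⟩
      n ∸ k         ≡⟨ cong (_∸ k) n≡k+l ⟩
      k + l ∸ k     ≡⟨ m+n∸m≡n k l ⟩
      l             ∎

data ΥVertex : Set where
  a b : Fin 5 → ΥVertex
  c   : ΥVertex

data ΥEdge : Rel ΥVertex 0ℓ where
  ac  : ∀ j → ΥEdge (a j) c
  ab⁺ : ∀ j → ΥEdge (a j) (b (j ⊕ 2F))
  ab⁻ : ∀ j → ΥEdge (a j) (b (j ⊖ 2F))
  bb  : ∀ j → ΥEdge (b j) (b (j ⊕ 2F))

Υ : Graph ΥVertex
Υ = record
  { Adj        = SymClosure ΥEdge
  ; Adj-sym    = symmetric ΥEdge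
  ; Adj-irrefl = λ { x≡y (fwd e) → loopless x≡y e ; x≡y (bwd e) → loopless (sym x≡y) e }
  }
  where
  loopless : Irreflexive _≡_ ΥEdge
  loopless () (bb 0F)
  loopless () (bb 1F)
  loopless () (bb 2F)
  loopless () (bb 3F)
  loopless () (bb 4F)

-- Three independent vertices have a common neighbour, as otherwise D₂ and D₃
-- yield a copy of Υ. Consequently every vertex v has a neighbour on each 5-cycle:
-- if not, common neighbours of v and the non-adjacent pairs of the cycle give Υ.
-- This excludes K₄,₄ minus a perfect matching as an induced subgraph, so by
-- induction every independent set has a common neighbour.
--
-- Take a largest Andrásfai graph Γ_k in G. As every 5-cycle of Γ_k meets the
-- neighbourhood of v, v is adjacent to k − 1 consecutive vertices of Γ_k. If it
-- is adjacent to k of them, it has the same neighbours in Γ_k as some vertex of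
-- Γ_k. Otherwise v, a common neighbour of v and the k vertices preceding the
-- k − 1, and a common neighbour of v and the k vertices following them extend
-- Γ_k to Γ_{k+1}. So each vertex of G imitates a vertex of Γ_k, and by
-- maximality G is a blow-up of Γ_k.

module Submission where

open import Data.Empty using (⊥; ⊥-elim)
open import Data.Fin using (Fin; toℕ; fromℕ<; #_)
open import Data.Fin.Patterns using (0F; 1F; 2F; 3F; 4F)
open import Data.Fin.Properties
  using (toℕ<n; toℕ-fromℕ<; toℕ-injective; all?; any?; injective⇒≤; sequence) renaming (_≟_ to _≟F_)
open import Data.Fin.Subset using (Subset; ∣_∣; _∈_)
open import Data.Fin.Subset.Properties using (anySubset?; _∈?_)
open import Data.List using (List; []; _∷_; applyUpTo)
open import Data.List.Relation.Unary.All as All using (All)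
import Data.List.Relation.Unary.All.Properties as All
open import Data.List.Relation.Unary.AllPairs using (AllPairs)
import Data.List.Relation.Unary.AllPairs.Properties as AllPairs
open import Data.List.Relation.Unary.Any as Any using (Any; here; there)
open import Data.Nat
  using (ℕ; zero; suc; _+_; _*_; _∸_; _≤_; _<_; _≤?_; _<?_; z≤n; s≤s; NonZero; >-nonZero⁻¹)
open import Data.Nat.DivMod using (_%_; _/_; m%n<n; m%n%n≡m%n; m≡m%n+[m/n]*n; [m+kn]%n≡m%n; m<n⇒m%n≡m)
open import Data.Nat.Properties
open import Data.Nat.Tactic.RingSolver using (solve)
open import Data.Product using (∃-syntax; _×_; _,_; proj₁; proj₂)
open import Data.Sum using (_⊎_; inj₁; inj₂; map₁; [_,_]′)
open import Data.Sum.Effectful.Right using (applicative)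
open import Data.Vec using (Vec; lookup; map; count)
open import Data.Vec.Properties using (lookup-map; []=⇒lookup)
open import Function using (_∘_)
open import Level using (0ℓ)
open import Relation.Binary.Construct.Closure.Symmetric using (fwd; bwd)
open import Relation.Binary.Definitions using (Decidable; tri<; tri≈; tri>)
open import Relation.Binary.PropositionalEquality
open import Relation.Nullary using (¬_; Dec; yes; no; does; contradiction)
open import Relation.Nullary.Decidable
  using (from-yes; False; toWitnessFalse; _×-dec_; _⊎-dec_; ¬?; decidable-stable)
open import Defs

-- Triangle-free graphs and property D as a source of common neighbours.

module TriangleFree {n : ℕ} (G : Graph (Fin n)) (adj? : Decidable (Adj G)) (noTriangle : ¬ HasTriangle G) where

  open import Data.List.Relation.Unary.All using ([]; _∷_)
  open import Data.Vec using ([]; _∷_)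

  infix 4 _~_ _≁_

  _~_ _≁_ : Fin n → Fin n → Set
  u ~ v = Adj G u v
  u ≁ v = ¬ u ~ v

  ~-sym : ∀ {u v} → u ~ v → v ~ u
  ~-sym = Adj-sym G

  ≁-sym : ∀ {u v} → u ≁ v → v ≁ u
  ≁-sym u≁v v~u = u≁v (~-sym v~u)

  ~⇒≢ : ∀ {u v} → u ~ v → u ≢ v
  ~⇒≢ u~v u≡v = Adj-irrefl G u≡v u~v

  ≁-by : ∀ {u v} w → w ~ u → w ~ v → u ≁ v
  ≁-by w w~u w~v u~v = noTriangle (w , _ , _ , w~u , u~v , w~v)

  -- With equal ends the walk would close up to a triangle.
  walk₃⇒≢ : ∀ {x p q y} → x ~ p → p ~ q → q ~ y → x ≢ y
  walk₃⇒≢ x~p p~q q~x refl = ≁-by _ x~p (~-sym q~x) p~q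

  Covered : ∀ {k} → List (Fin k × Fin k) → List (List (Fin k)) → Subset k → Set
  Covered es gs S =
    Any (λ e → proj₁ e ∈ S × proj₂ e ∈ S) es ⊎ Any (All (_∈ S)) gs

  covered? : ∀ {k} es gs (S : Subset k) → Dec (Covered es gs S)
  covered? es gs S =
    Any.any? (λ e → (proj₁ e ∈? S) ×-dec (proj₂ e ∈? S)) es ⊎-dec Any.any? (All.all? (_∈? S)) gs

  -- The search speaks of positions only, never of the graph. For concrete `m`, `es` and `gs` it
  -- therefore evaluates during type checking, and `False (uncovered? m es gs)` is filled by `_`.
  uncovered? : ∀ {k} m es gs → Dec (∃[ S ] (m + 1 ≤ ∣ S ∣ × ¬ Covered {k} es gs S))
  uncovered? m es gs = anySubset? (λ S → (m + 1 ≤? ∣ S ∣) ×-dec ¬? (covered? es gs S))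

  seenFrom : ∀ {k} → Vec (Fin n) k → Fin n → Subset k
  seenFrom xs w = map (λ x → does (adj? x w)) xs

  ∣seenFrom∣ : ∀ {k} (xs : Vec (Fin n) k) w → ∣ seenFrom xs w ∣ ≡ count (λ x → adj? x w) xs
  ∣seenFrom∣ []       w = refl
  ∣seenFrom∣ (x ∷ xs) w with adj? x w
  ... | yes _ = cong suc (∣seenFrom∣ xs w)
  ... | no  _ = ∣seenFrom∣ xs w

  ∈seenFrom⇒~ : ∀ {k} (xs : Vec (Fin n) k) w {i} → i ∈ seenFrom xs w → w ~ lookup xs i
  ∈seenFrom⇒~ xs w {i} i∈ with adj? (lookup xs i) w | trans (sym (lookup-map i (λ x → does (adj? x w)) xs)) ([]=⇒lookup i∈)
  ... | yes x~w | _ = ~-sym x~w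
  ... | no _    | ()

  module _ {ℓ : ℕ} (D : PropertyD G adj? ℓ) where

    -- Each hypothesis of 'edges' excludes a pair of positions; the decision
    -- procedure checks that a set of m + 1 positions avoiding these pairs
    -- contains one of the sets in gs.
    commonNeighbour : ∀ m → 1 ≤ m → m ≤ ℓ → (xs : Vec (Fin n) (3 * m)) →
      ∀ es gs → All (λ e → lookup xs (proj₁ e) ~ lookup xs (proj₂ e)) es →
      False (uncovered? m es gs) →
      ∃[ w ] Any (All (λ i → w ~ lookup xs i)) gs
    commonNeighbour m 1≤m m≤ℓ xs es gs edges check with D m 1≤m m≤ℓ xs
    ... | w , m<count with decidable-stable (covered? es gs S) (λ uncov → toWitnessFalse check (S , m<∣S∣ , uncov))
      where
      S = seenFrom xs w
      m<∣S∣ = subst (m + 1 ≤_) (sym (∣seenFrom∣ xs w)) m<count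
    ... | inj₁ edge = ⊥-elim (impossible edges edge)
      where
      impossible : ∀ {es} → All (λ e → lookup xs (proj₁ e) ~ lookup xs (proj₂ e)) es →
        ¬ Any (λ e → proj₁ e ∈ seenFrom xs w × proj₂ e ∈ seenFrom xs w) es
      impossible (x~y ∷ _) (here (i∈ , j∈)) = ≁-by w (∈seenFrom⇒~ xs w i∈) (∈seenFrom⇒~ xs w j∈) x~y
      impossible (_ ∷ edges) (there e)      = impossible edges e
    ... | inj₂ good = w , Any.map (All.map (∈seenFrom⇒~ xs w)) good

-- Indices modulo 5 and copies of Υ.

five : ∀ {P : Fin 5 → Set} → P 0F → P 1F → P 2F → P 3F → P 4F → ∀ j → P j
five p₀ p₁ p₂ p₃ p₄ 0F = p₀
five p₀ p₁ p₂ p₃ p₄ 1F = p₁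
five p₀ p₁ p₂ p₃ p₄ 2F = p₂
five p₀ p₁ p₂ p₃ p₄ 3F = p₃
five p₀ p₁ p₂ p₃ p₄ 4F = p₄

⊕2⊖2 : ∀ (j : Fin 5) → j ⊕ 2F ⊖ 2F ≡ j
⊕2⊖2 = from-yes (all? λ (j : Fin 5) → j ⊕ 2F ⊖ 2F ≟F j)

⊖2⊕2 : ∀ (j : Fin 5) → j ⊖ 2F ⊕ 2F ≡ j
⊖2⊕2 = from-yes (all? λ (j : Fin 5) → j ⊖ 2F ⊕ 2F ≟F j)

⊕1⊖2 : ∀ (j : Fin 5) → j ⊕ 1F ⊖ 2F ≡ j ⊕ 2F ⊕ 2F
⊕1⊖2 = from-yes (all? λ (j : Fin 5) → j ⊕ 1F ⊖ 2F ≟F j ⊕ 2F ⊕ 2F)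

⊕2⊕2⊕2 : ∀ (j : Fin 5) → j ⊕ 2F ⊕ 2F ⊕ 2F ≡ j ⊕ 1F
⊕2⊕2⊕2 = from-yes (all? λ (j : Fin 5) → j ⊕ 2F ⊕ 2F ⊕ 2F ≟F j ⊕ 1F)

≡⊎apart₁⊎apart₂ : ∀ (i j : Fin 5) →
  i ≡ j ⊎ (j ≡ i ⊕ 1F ⊎ i ≡ j ⊕ 1F) ⊎ (j ≡ i ⊕ 2F ⊎ i ≡ j ⊕ 2F)
≡⊎apart₁⊎apart₂ = from-yes (all? λ (i : Fin 5) → all? λ (j : Fin 5) →
  (i ≟F j) ⊎-dec ((j ≟F i ⊕ 1F) ⊎-dec (i ≟F j ⊕ 1F)) ⊎-dec ((j ≟F i ⊕ 2F) ⊎-dec (i ≟F j ⊕ 2F)))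

-- Two distinct non-adjacent vertices of Υ are the ends of a walk of length 3,
-- so a homomorphism from Υ to a triangle-free graph is injective.
module _ {n : ℕ} (G : Graph (Fin n)) (adj? : Decidable (Adj G)) (noTriangle : ¬ HasTriangle G) where

  open TriangleFree G adj? noTriangle

  Υ⊑ : (A B : Fin 5 → Fin n) (C : Fin n) →
    (∀ j → A j ~ C) → (∀ j → A j ~ B (j ⊕ 2F)) → (∀ j → A j ~ B (j ⊖ 2F)) →
    (∀ j → B j ~ B (j ⊕ 2F)) → Υ ⊑ G
  Υ⊑ A B C A~C A~B⁺ A~B⁻ B~B = f , f-injective , f-hom
    where
    f : ΥVertex → Fin n
    f (a j) = A j
    f (b j) = B j
    f c     = C

    f-hom : ∀ {x y} → Adj Υ x y → f x ~ f y
    f-hom (fwd (ac j))  = A~C j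
    f-hom (fwd (ab⁺ j)) = A~B⁺ j
    f-hom (fwd (ab⁻ j)) = A~B⁻ j
    f-hom (fwd (bb j))  = B~B j
    f-hom (bwd (ac j))  = ~-sym (A~C j)
    f-hom (bwd (ab⁺ j)) = ~-sym (A~B⁺ j)
    f-hom (bwd (ab⁻ j)) = ~-sym (A~B⁻ j)
    f-hom (bwd (bb j))  = ~-sym (B~B j)

    A≢A₁ : ∀ j → A j ≢ A (j ⊕ 1F)
    A≢A₁ j = walk₃⇒≢ (A~B⁺ j) (B~B (j ⊕ 2F))
      (~-sym (subst (λ i → A (j ⊕ 1F) ~ B i) (⊕1⊖2 j) (A~B⁻ (j ⊕ 1F))))

    A≢A₂ : ∀ j → A j ≢ A (j ⊕ 2F)
    A≢A₂ j = walk₃⇒≢ (A~B⁺ j) (B~B (j ⊕ 2F)) (~-sym (A~B⁺ (j ⊕ 2F)))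

    B≢B₁ : ∀ j → B j ≢ B (j ⊕ 1F)
    B≢B₁ j = subst (λ i → B j ≢ B i) (⊕2⊕2⊕2 j)
      (walk₃⇒≢ (B~B j) (B~B (j ⊕ 2F)) (B~B (j ⊕ 2F ⊕ 2F)))

    A≢B : ∀ i j → A i ≢ B j
    A≢B i j = walk₃⇒≢ (A~C i) (~-sym (A~C (j ⊕ 2F)))
      (subst (λ k → A (j ⊕ 2F) ~ B k) (⊕2⊖2 j) (A~B⁻ (j ⊕ 2F)))

    B≢C : ∀ j → B j ≢ C
    B≢C j = walk₃⇒≢ (B~B j) (~-sym (A~B⁺ j)) (A~C j)

    f-injective : ∀ {x y} → f x ≡ f y → x ≡ y
    f-injective {a i} {a j} eq with ≡⊎apart₁⊎apart₂ i j
    ... | inj₁ i≡j                  = cong a i≡j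
    ... | inj₂ (inj₁ (inj₁ refl))   = contradiction eq (A≢A₁ i)
    ... | inj₂ (inj₁ (inj₂ refl))   = contradiction (sym eq) (A≢A₁ j)
    ... | inj₂ (inj₂ (inj₁ refl))   = contradiction eq (A≢A₂ i)
    ... | inj₂ (inj₂ (inj₂ refl))   = contradiction (sym eq) (A≢A₂ j)
    f-injective {a i} {b j} eq = contradiction eq (A≢B i j)
    f-injective {a i} {c}   eq = contradiction eq (~⇒≢ (A~C i))
    f-injective {b i} {a j} eq = contradiction (sym eq) (A≢B j i)
    f-injective {b i} {b j} eq with ≡⊎apart₁⊎apart₂ i j
    ... | inj₁ i≡j                  = cong b i≡j
    ... | inj₂ (inj₁ (inj₁ refl))   = contradiction eq (B≢B₁ i)
    ... | inj₂ (inj₁ (inj₂ refl))   = contradiction (sym eq) (B≢B₁ j)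
    ... | inj₂ (inj₂ (inj₁ refl))   = contradiction eq (~⇒≢ (B~B i))
    ... | inj₂ (inj₂ (inj₂ refl))   = contradiction (sym eq) (~⇒≢ (B~B j))
    f-injective {b i} {c}   eq = contradiction eq (B≢C i)
    f-injective {c} {a j}   eq = contradiction (sym eq) (~⇒≢ (A~C j))
    f-injective {c} {b j}   eq = contradiction (sym eq) (B≢C j)
    f-injective {c} {c}     eq = refl

-- Common neighbours of independent sets.

module Independent {n : ℕ} (G : Graph (Fin n)) (adj? : Decidable (Adj G))
  (maximal : MaximalTriangleFree G) (noΥ : ¬ (Υ ⊑ G)) (D : PropertyD G adj? 3) where

  open import Data.List.Relation.Unary.All using ([]; _∷_)
  open import Data.List.Relation.Unary.AllPairs using ([]; _∷_)
  open import Data.Vec using ([]; _∷_)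

  open TriangleFree G adj? (proj₁ maximal) public

  neighbour : ∀ v → ∃[ w ] w ~ v
  -- For `m = 1` and the constant sequence `v, v, v`, two of the three positions are hit.
  neighbour v with commonNeighbour D 1 (s≤s z≤n) (s≤s z≤n) (v ∷ v ∷ v ∷ []) [] ((0F ∷ []) ∷ (1F ∷ []) ∷ (2F ∷ []) ∷ []) [] _
  ... | w , here (w~v ∷ _)                 = w , w~v
  ... | w , there (here (w~v ∷ _))         = w , w~v
  ... | w , there (there (here (w~v ∷ _))) = w , w~v

  New : (u v x y : Fin n) → Set
  New u v x y = (x ≡ u × y ≡ v) ⊎ (x ≡ v × y ≡ u)

  new-sym : ∀ {u v x y} → New u v x y → New u v y x
  new-sym (inj₁ (x≡u , y≡v)) = inj₂ (y≡v , x≡u)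
  new-sym (inj₂ (x≡v , y≡u)) = inj₁ (y≡u , x≡v)

  -- If two sides of a triangle were the added edge, the third would be a loop. So a triangle
  -- created by an added edge uses it once.
  new-new⇒≡ : ∀ {u v x y z} → u ≢ v → New u v x y → New u v y z → x ≡ z
  new-new⇒≡ u≢v (inj₁ (_ , y≡v))    (inj₁ (y≡u , _))    = contradiction (trans (sym y≡u) y≡v) u≢v
  new-new⇒≡ u≢v (inj₁ (refl , _))   (inj₂ (_ , refl))   = refl
  new-new⇒≡ u≢v (inj₂ (refl , _))   (inj₁ (_ , refl))   = refl
  new-new⇒≡ u≢v (inj₂ (_ , y≡u))    (inj₂ (y≡v , _))    = contradiction (trans (sym y≡u) y≡v) u≢v

  common₂ : ∀ {u v} → u ≁ v → ∃[ w ] (w ~ u × w ~ v)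
  common₂ {u} {v} u≁v with u ≟F v
  ... | yes refl with neighbour u
  ...   | w , w~u = w , w~u , w~u
  common₂ {u} {v} u≁v | no u≢v with proj₂ maximal u v u≢v u≁v
  ... | x , y , z , inj₁ xy , inj₁ yz , inj₁ xz = contradiction (x , y , z , xy , yz , xz) (proj₁ maximal)
  ... | x , y , z , inj₂ (inj₁ (refl , refl)) , inj₁ yz , inj₁ xz = z , ~-sym xz , ~-sym yz
  ... | x , y , z , inj₂ (inj₂ (refl , refl)) , inj₁ yz , inj₁ xz = z , ~-sym yz , ~-sym xz
  ... | x , y , z , inj₁ xy , inj₂ (inj₁ (refl , refl)) , inj₁ xz = x , xy , xz
  ... | x , y , z , inj₁ xy , inj₂ (inj₂ (refl , refl)) , inj₁ xz = x , xz , xy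
  ... | x , y , z , inj₁ xy , inj₁ yz , inj₂ (inj₁ (refl , refl)) = y , ~-sym xy , yz
  ... | x , y , z , inj₁ xy , inj₁ yz , inj₂ (inj₂ (refl , refl)) = y , yz , ~-sym xy
  ... | x , y , z , inj₂ xy , inj₂ yz , xz = contradiction xz (Adj-irrefl (addEdge G u v u≢v) (new-new⇒≡ u≢v xy yz))
  ... | x , y , z , inj₂ xy , yz , inj₂ xz = contradiction yz (Adj-irrefl (addEdge G u v u≢v) (new-new⇒≡ u≢v (new-sym xy) xz))
  ... | x , y , z , xy , inj₂ yz , inj₂ xz = contradiction xy (Adj-irrefl (addEdge G u v u≢v) (new-new⇒≡ u≢v xz (new-sym yz)))

  -- The 6-cycle `x₁ y₂ x₃ y₁ x₂ y₃`, that is, K₃,₃ minus the matching of the pairs `xᵢ`, `yᵢ`;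
  -- nothing is asked of these pairs.
  record Hexagon (x₁ x₂ x₃ y₁ y₂ y₃ : Fin n) : Set where
    constructor hexagon
    field
      x₁y₂ : x₁ ~ y₂
      x₁y₃ : x₁ ~ y₃
      x₂y₁ : x₂ ~ y₁
      x₂y₃ : x₂ ~ y₃
      x₃y₁ : x₃ ~ y₁
      x₃y₂ : x₃ ~ y₂

  open Hexagon

  rotate : ∀ {x₁ x₂ x₃ y₁ y₂ y₃} → Hexagon x₁ x₂ x₃ y₁ y₂ y₃ → Hexagon x₂ x₃ x₁ y₂ y₃ y₁
  rotate h = hexagon (x₂y₃ h) (x₂y₁ h) (x₃y₂ h) (x₃y₁ h) (x₁y₂ h) (x₁y₃ h)

  swap₂₃ : ∀ {x₁ x₂ x₃ y₁ y₂ y₃} → Hexagon x₁ x₂ x₃ y₁ y₂ y₃ → Hexagon x₁ x₃ x₂ y₁ y₃ y₂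
  swap₂₃ h = hexagon (x₁y₃ h) (x₁y₂ h) (x₃y₁ h) (x₃y₂ h) (x₂y₁ h) (x₂y₃ h)

  common₃ : Fin n → Fin n → Fin n → Set
  common₃ u v w = ∃[ t ] (t ~ u × t ~ v × t ~ w)

  -- Property D for `m = 2` yields a vertex adjacent to three of the six. They are independent, and
  -- the only independent triples of a 6-cycle are its colour classes.
  hexagon⇒common₃ : ∀ {x₁ x₂ x₃ y₁ y₂ y₃} → Hexagon x₁ x₂ x₃ y₁ y₂ y₃ →
    common₃ x₁ x₂ x₃ ⊎ common₃ y₁ y₂ y₃
  hexagon⇒common₃ {x₁} {x₂} {x₃} {y₁} {y₂} {y₃} h
    with commonNeighbour D 2 (s≤s z≤n) (s≤s (s≤s z≤n)) (x₁ ∷ x₂ ∷ x₃ ∷ y₁ ∷ y₂ ∷ y₃ ∷ [])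
           ((# 0 , # 4) ∷ (# 0 , # 5) ∷ (# 1 , # 3) ∷ (# 1 , # 5) ∷ (# 2 , # 3) ∷ (# 2 , # 4) ∷ [])
           ((# 0 ∷ # 1 ∷ # 2 ∷ []) ∷ (# 3 ∷ # 4 ∷ # 5 ∷ []) ∷ [])
           (x₁y₂ h ∷ x₁y₃ h ∷ x₂y₁ h ∷ x₂y₃ h ∷ x₃y₁ h ∷ x₃y₂ h ∷ []) _
  ... | t , here (e₁ ∷ e₂ ∷ e₃ ∷ [])         = inj₁ (t , e₁ , e₂ , e₃)
  ... | t , there (here (e₁ ∷ e₂ ∷ e₃ ∷ [])) = inj₂ (t , e₁ , e₂ , e₃)

  -- A common neighbour `t` would complete Υ: the hub is `y₂`, its neighbours are `t`, `z₂`, `x₁`,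
  -- `z`, `x₃`, and the 5-cycle is `y₃ z₃ w₁ y₁ x₂`.
  hexagon-noCommon₃ : ∀ {x₁ x₂ x₃ y₁ y₂ y₃ z w₁ z₂ z₃} → Hexagon x₁ x₂ x₃ y₁ y₂ y₃ →
    z ~ y₁ → z ~ y₂ → z ~ y₃ → w₁ ~ x₁ → w₁ ~ y₁ → w₁ ~ z₂ → w₁ ~ z₃ →
    z₂ ~ x₂ → z₂ ~ y₂ → z₃ ~ x₃ → z₃ ~ y₃ → ¬ common₃ x₂ y₂ z₃
  hexagon-noCommon₃ {x₁} {x₂} {x₃} {y₁} {y₂} {y₃} {z} {w₁} {z₂} {z₃}
    h zy₁ zy₂ zy₃ wx₁ wy₁ wz₂ wz₃ zx₂ z₂y₂ zx₃ z₃y₃ (t , tx₂ , ty₂ , tz₃) =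
    noΥ (Υ⊑ G adj? (proj₁ maximal)
      (lookup (t ∷ z₂ ∷ x₁ ∷ z ∷ x₃ ∷ [])) (lookup (y₃ ∷ y₁ ∷ z₃ ∷ x₂ ∷ w₁ ∷ [])) y₂
      (five ty₂ z₂y₂ (x₁y₂ h) zy₂ (x₃y₂ h))
      (five tz₃ zx₂ (~-sym wx₁) zy₃ (x₃y₁ h))
      (five tx₂ (~-sym wz₂) (x₁y₃ h) zy₁ (~-sym zx₃))
      (five (~-sym z₃y₃) (~-sym (x₂y₁ h)) (~-sym wz₃) (x₂y₃ h) wy₁))

  -- The 6-cycle `x₂ y₃ z₃ x₃ y₂ z₂` has the colour classes `x₂, y₂, z₃` and `x₃, y₃, z₂`. One of
  -- them has a common neighbour, and exchanging the indices 2 and 3 swaps the two cases.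
  hexagon-noFan : ∀ {x₁ x₂ x₃ y₁ y₂ y₃ z w₁ z₂ z₃} → Hexagon x₁ x₂ x₃ y₁ y₂ y₃ →
    z ~ y₁ → z ~ y₂ → z ~ y₃ → w₁ ~ x₁ → w₁ ~ y₁ → w₁ ~ z₂ → w₁ ~ z₃ →
    z₂ ~ x₂ → z₂ ~ y₂ → z₃ ~ x₃ → z₃ ~ y₃ → ⊥
  hexagon-noFan h zy₁ zy₂ zy₃ wx₁ wy₁ wz₂ wz₃ zx₂ z₂y₂ zx₃ z₃y₃
    with hexagon⇒common₃ (hexagon (x₂y₃ h) (~-sym zx₂) (~-sym (x₃y₂ h)) (~-sym z₂y₂) zx₃ z₃y₃)
  ... | inj₁ common = hexagon-noCommon₃ h zy₁ zy₂ zy₃ wx₁ wy₁ wz₂ wz₃ zx₂ z₂y₂ zx₃ z₃y₃ common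
  ... | inj₂ common = hexagon-noCommon₃ (swap₂₃ h) zy₁ zy₃ zy₂ wx₁ wy₁ wz₃ wz₂ zx₃ z₃y₃ zx₂ z₂y₂ common

  -- Let `yᵢ` be a common neighbour of the two vertices other than `xᵢ`. If no `yᵢ` sees `xᵢ`, a
  -- hexagon arises; its colour class of the `yᵢ` may be assumed to have a common neighbour `z`. Let
  -- `zᵢ` be a common neighbour of `xᵢ` and `yᵢ`. Property D for `m = 3` gives a `w` adjacent to
  -- four of these nine vertices. The only independent quadruples allowed by the known edges consist
  -- of `xᵢ`, `yᵢ` and the two `zⱼ` with j ≠ i, and `hexagon-noFan` excludes them.
  independent⇒common₃ : ∀ {x₁ x₂ x₃} → x₁ ≁ x₂ → x₁ ≁ x₃ → x₂ ≁ x₃ → common₃ x₁ x₂ x₃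
  independent⇒common₃ {x₁} {x₂} {x₃} n₁₂ n₁₃ n₂₃ with common₂ n₂₃ | common₂ n₁₃ | common₂ n₁₂
  ... | y₁ , yx₁₂ , yx₁₃ | y₂ , yx₂₁ , yx₂₃ | y₃ , yx₃₁ , yx₃₂
    with adj? y₁ x₁ | adj? y₂ x₂ | adj? y₃ x₃
  ... | yes e | _     | _     = y₁ , e , yx₁₂ , yx₁₃
  ... | no _  | yes e | _     = y₂ , yx₂₁ , e , yx₂₃
  ... | no _  | no _  | yes e = y₃ , yx₃₁ , yx₃₂ , e
  ... | no n₁ | no n₂ | no n₃
    with hexagon⇒common₃ h | common₂ n₁ | common₂ n₂ | common₂ n₃
    where h = hexagon (~-sym yx₂₁) (~-sym yx₃₁) (~-sym yx₁₂) (~-sym yx₃₂) (~-sym yx₁₃) (~-sym yx₂₃)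
  ... | inj₁ common              | _ | _ | _ = common
  ... | inj₂ (z , zy₁ , zy₂ , zy₃) | z₁ , zy₁₁ , zx₁₁ | z₂ , zy₂₂ , zx₂₂ | z₃ , zy₃₃ , zx₃₃
    = ⊥-elim (contra (commonNeighbour D 3 (s≤s z≤n) ≤-refl
        (x₁ ∷ x₂ ∷ x₃ ∷ y₁ ∷ y₂ ∷ y₃ ∷ z₁ ∷ z₂ ∷ z₃ ∷ [])
        ((# 0 , # 4) ∷ (# 0 , # 5) ∷ (# 1 , # 3) ∷ (# 1 , # 5) ∷ (# 2 , # 3) ∷ (# 2 , # 4) ∷
         (# 6 , # 0) ∷ (# 7 , # 1) ∷ (# 8 , # 2) ∷ (# 6 , # 3) ∷ (# 7 , # 4) ∷ (# 8 , # 5) ∷ [])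
        ((# 0 ∷ # 3 ∷ # 7 ∷ # 8 ∷ []) ∷ (# 1 ∷ # 4 ∷ # 8 ∷ # 6 ∷ []) ∷ (# 2 ∷ # 5 ∷ # 6 ∷ # 7 ∷ []) ∷ [])
        (x₁y₂ h ∷ x₁y₃ h ∷ x₂y₁ h ∷ x₂y₃ h ∷ x₃y₁ h ∷ x₃y₂ h ∷
         zx₁₁ ∷ zx₂₂ ∷ zx₃₃ ∷ zy₁₁ ∷ zy₂₂ ∷ zy₃₃ ∷ []) _))
    where
    h = hexagon (~-sym yx₂₁) (~-sym yx₃₁) (~-sym yx₁₂) (~-sym yx₃₂) (~-sym yx₁₃) (~-sym yx₂₃)
    contra : ¬ (∃[ w ] Any (All (λ i → w ~ lookup (x₁ ∷ x₂ ∷ x₃ ∷ y₁ ∷ y₂ ∷ y₃ ∷ z₁ ∷ z₂ ∷ z₃ ∷ []) i))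
      ((# 0 ∷ # 3 ∷ # 7 ∷ # 8 ∷ []) ∷ (# 1 ∷ # 4 ∷ # 8 ∷ # 6 ∷ []) ∷ (# 2 ∷ # 5 ∷ # 6 ∷ # 7 ∷ []) ∷ []))
    contra (w , here (e₁ ∷ e₂ ∷ e₃ ∷ e₄ ∷ [])) =
      hexagon-noFan h zy₁ zy₂ zy₃ e₁ e₂ e₃ e₄ zx₂₂ zy₂₂ zx₃₃ zy₃₃
    contra (w , there (here (e₁ ∷ e₂ ∷ e₃ ∷ e₄ ∷ []))) =
      hexagon-noFan (rotate h) zy₂ zy₃ zy₁ e₁ e₂ e₃ e₄ zx₃₃ zy₃₃ zx₁₁ zy₁₁
    contra (w , there (there (here (e₁ ∷ e₂ ∷ e₃ ∷ e₄ ∷ [])))) =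
      hexagon-noFan (rotate (rotate h)) zy₃ zy₁ zy₂ e₁ e₂ e₃ e₄ zx₁₁ zy₁₁ zx₂₂ zy₂₂

  -- 5-cycles, crowns and larger independent sets.

  pentagon-dominates : ∀ v {p₀ p₁ p₂ p₃ p₄} → p₀ ~ p₁ → p₁ ~ p₂ → p₂ ~ p₃ → p₃ ~ p₄ → p₄ ~ p₀ →
    v ~ p₀ ⊎ v ~ p₁ ⊎ v ~ p₂ ⊎ v ~ p₃ ⊎ v ~ p₄
  pentagon-dominates v {p₀} {p₁} {p₂} {p₃} {p₄} e₀₁ e₁₂ e₂₃ e₃₄ e₄₀ with any? (λ j → adj? v (B j))
    -- The cycle is listed so that each step along it raises the index by 2, as along the edges `bb`
    -- of Υ.
    where B = lookup (p₀ ∷ p₃ ∷ p₁ ∷ p₄ ∷ p₂ ∷ [])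
  ... | yes (0F , e) = inj₁ e
  ... | yes (1F , e) = inj₂ (inj₂ (inj₂ (inj₁ e)))
  ... | yes (2F , e) = inj₂ (inj₁ e)
  ... | yes (3F , e) = inj₂ (inj₂ (inj₂ (inj₂ e)))
  ... | yes (4F , e) = inj₂ (inj₂ (inj₁ e))
  ... | no v≁B = contradiction
      (Υ⊑ G adj? (proj₁ maximal) (proj₁ ∘ A) B v
        (λ j → proj₁ (proj₂ (A j))) (λ j → proj₁ (proj₂ (proj₂ (A j)))) (λ j → proj₂ (proj₂ (proj₂ (A j)))) B~B)
      noΥ
    where
    B = lookup (p₀ ∷ p₃ ∷ p₁ ∷ p₄ ∷ p₂ ∷ [])
    B~B : ∀ j → B j ~ B (j ⊕ 2F)
    B~B = five e₀₁ e₃₄ e₁₂ e₄₀ e₂₃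
    A : ∀ j → common₃ v (B (j ⊕ 2F)) (B (j ⊖ 2F))
    A j = independent⇒common₃ (v≁B ∘ (j ⊕ 2F ,_)) (v≁B ∘ (j ⊖ 2F ,_))
      (≁-by (B j) (B~B j) (~-sym (subst (λ i → B (j ⊖ 2F) ~ B i) (⊖2⊕2 j) (B~B (j ⊖ 2F)))))

  -- w₁ is adjacent to some vertex of the 5-cycle w₀ x₀ y₂ x₃ y₀, and w₀ is the
  -- only candidate.
  crown⇒~ : ∀ {x₀ x₁ x₃ y₀ y₁ y₂ w₀ w₁} →
    x₀ ~ y₁ → x₀ ~ y₂ → x₁ ~ y₀ → x₁ ~ y₂ → x₃ ~ y₀ → x₃ ~ y₁ → x₃ ~ y₂ →
    w₀ ~ x₀ → w₀ ~ y₀ → w₁ ~ x₁ → w₁ ~ y₁ → w₁ ~ w₀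
  crown⇒~ {x₀} {x₁} {x₃} {y₀} {y₁} {y₂} {w₀} {w₁} x₀y₁ x₀y₂ x₁y₀ x₁y₂ x₃y₀ x₃y₁ x₃y₂ w₀x₀ w₀y₀ w₁x₁ w₁y₁
    with pentagon-dominates w₁ w₀x₀ x₀y₂ (~-sym x₃y₂) x₃y₀ (~-sym w₀y₀)
  ... | inj₁ e                      = e
  ... | inj₂ (inj₁ e)               = contradiction x₀y₁ (≁-by w₁ e w₁y₁)
  ... | inj₂ (inj₂ (inj₁ e))        = contradiction x₁y₂ (≁-by w₁ w₁x₁ e)
  ... | inj₂ (inj₂ (inj₂ (inj₁ e))) = contradiction x₃y₁ (≁-by w₁ e w₁y₁)
  ... | inj₂ (inj₂ (inj₂ (inj₂ e))) = contradiction x₁y₀ (≁-by w₁ w₁x₁ e)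

  -- Otherwise take common neighbours `wᵢ` of `xᵢ` and `yᵢ` for i = 0, 1, 2; by `crown⇒~` they form
  -- a triangle.
  noCrown : ∀ {x₀ x₁ x₂ x₃ y₀ y₁ y₂ y₃} →
    y₀ ~ x₁ → y₀ ~ x₂ → y₀ ~ x₃ → y₁ ~ x₀ → y₁ ~ x₂ → y₁ ~ x₃ →
    y₂ ~ x₀ → y₂ ~ x₁ → y₂ ~ x₃ → y₃ ~ x₀ → y₃ ~ x₁ → y₃ ~ x₂ →
    y₀ ~ x₀ ⊎ y₁ ~ x₁ ⊎ y₂ ~ x₂ ⊎ y₃ ~ x₃
  noCrown {x₀} {x₁} {x₂} {x₃} {y₀} {y₁} {y₂} {y₃} e₀₁ e₀₂ e₀₃ e₁₀ e₁₂ e₁₃ e₂₀ e₂₁ e₂₃ e₃₀ e₃₁ e₃₂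
    with adj? y₀ x₀ | adj? y₁ x₁ | adj? y₂ x₂ | adj? y₃ x₃
  ... | yes e | _     | _     | _     = inj₁ e
  ... | no _  | yes e | _     | _     = inj₂ (inj₁ e)
  ... | no _  | no _  | yes e | _     = inj₂ (inj₂ (inj₁ e))
  ... | no _  | no _  | no _  | yes e = inj₂ (inj₂ (inj₂ e))
  ... | no n₀ | no n₁ | no n₂ | no n₃ with common₂ n₀ | common₂ n₁ | common₂ n₂
  ...   | w₀ , w₀y₀ , w₀x₀ | w₁ , w₁y₁ , w₁x₁ | w₂ , w₂y₂ , w₂x₂ = contradiction (w₂ , w₁ , w₀ , w₂w₁ , w₁w₀ , w₂w₀) (proj₁ maximal)
    where
    w₁w₀ = crown⇒~ (~-sym e₁₀) (~-sym e₂₀) (~-sym e₀₁) (~-sym e₂₁) (~-sym e₀₃) (~-sym e₁₃) (~-sym e₂₃) w₀x₀ w₀y₀ w₁x₁ w₁y₁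
    w₂w₀ = crown⇒~ (~-sym e₂₀) (~-sym e₁₀) (~-sym e₀₂) (~-sym e₁₂) (~-sym e₀₃) (~-sym e₂₃) (~-sym e₁₃) w₀x₀ w₀y₀ w₂x₂ w₂y₂
    w₂w₁ = crown⇒~ (~-sym e₂₁) (~-sym e₀₁) (~-sym e₁₂) (~-sym e₀₂) (~-sym e₁₃) (~-sym e₂₃) (~-sym e₀₃) w₁x₁ w₁y₁ w₂x₂ w₂y₂

  -- Induction on the size: omitting each of the first four vertices in turn gives `y₀`, ..., `y₃`,
  -- and by `noCrown` some `yᵢ` sees the omitted `xᵢ` as well.
  independent⇒common : ∀ {x₀ x₁ x₂} xs → AllPairs _≁_ (x₀ ∷ x₁ ∷ x₂ ∷ xs) →
    ∃[ y ] All (y ~_) (x₀ ∷ x₁ ∷ x₂ ∷ xs)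
  independent⇒common [] ((n₀₁ ∷ n₀₂ ∷ []) ∷ (n₁₂ ∷ []) ∷ _) with independent⇒common₃ n₀₁ n₀₂ n₁₂
  ... | y , yx₀ , yx₁ , yx₂ = y , yx₀ ∷ yx₁ ∷ yx₂ ∷ []
  independent⇒common (x₃ ∷ xs) ((n₀₁ ∷ n₀₂ ∷ n₀₃ ∷ n₀) ∷ (n₁₂ ∷ n₁₃ ∷ n₁) ∷ (n₂₃ ∷ n₂) ∷ n₃ ∷ ns)
    with independent⇒common xs ((n₁₂ ∷ n₁₃ ∷ n₁) ∷ (n₂₃ ∷ n₂) ∷ n₃ ∷ ns)
       | independent⇒common xs ((n₀₂ ∷ n₀₃ ∷ n₀) ∷ (n₂₃ ∷ n₂) ∷ n₃ ∷ ns)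
       | independent⇒common xs ((n₀₁ ∷ n₀₃ ∷ n₀) ∷ (n₁₃ ∷ n₁) ∷ n₃ ∷ ns)
       | independent⇒common xs ((n₀₁ ∷ n₀₂ ∷ n₀) ∷ (n₁₂ ∷ n₁) ∷ n₂ ∷ ns)
  ... | y₀ , e₀₁ ∷ e₀₂ ∷ e₀₃ ∷ e₀ | y₁ , e₁₀ ∷ e₁₂ ∷ e₁₃ ∷ e₁ | y₂ , e₂₀ ∷ e₂₁ ∷ e₂₃ ∷ e₂ | y₃ , e₃₀ ∷ e₃₁ ∷ e₃₂ ∷ e₃
    with noCrown e₀₁ e₀₂ e₀₃ e₁₀ e₁₂ e₁₃ e₂₀ e₂₁ e₂₃ e₃₀ e₃₁ e₃₂
  ... | inj₁ e₀₀               = y₀ , e₀₀ ∷ e₀₁ ∷ e₀₂ ∷ e₀₃ ∷ e₀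
  ... | inj₂ (inj₁ e₁₁)        = y₁ , e₁₀ ∷ e₁₁ ∷ e₁₂ ∷ e₁₃ ∷ e₁
  ... | inj₂ (inj₂ (inj₁ e₂₂)) = y₂ , e₂₀ ∷ e₂₁ ∷ e₂₂ ∷ e₂₃ ∷ e₂
  ... | inj₂ (inj₂ (inj₂ e₃₃)) = y₃ , e₃₀ ∷ e₃₁ ∷ e₃₂ ∷ e₃₃ ∷ e₃

  common-applyUpTo : ∀ v f k → (∀ {i} → i < k → v ≁ f i) → (∀ {i j} → i < j → j < k → f i ≁ f j) →
    ∃[ y ] (y ~ v × (∀ {i} → i < k → y ~ f i))
  common-applyUpTo v f k v≁f f≁f
    with independent⇒common (applyUpTo f k)
           -- Three copies of `v` supply the leading vertices of `independent⇒common`, so `k` may be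
           -- arbitrarily small.
           ((v≁v ∷ v≁v ∷ v≁fs) ∷ (v≁v ∷ v≁fs) ∷ v≁fs ∷ AllPairs.applyUpTo⁺₁ f k f≁f)
    where
    v≁v : v ≁ v
    v≁v = Adj-irrefl G refl
    v≁fs : All (v ≁_) (applyUpTo f k)
    v≁fs = All.applyUpTo⁺₁ f k v≁f
  ... | y , y~v ∷ _ ∷ _ ∷ ys = y , y~v , All.applyUpTo⁻ f k ys

-- Linear inequalities and periodic sequences.

-- A linear inequality is certified by a sum p ≤ q of hypotheses, a slack k and
-- a semiring identity.
≤-by : ∀ {p q x y} k → p ≤ q → x + q + k ≡ y + p → x ≤ y
≤-by {p} {q} {x} {y} k p≤q eq = +-cancelʳ-≤ p x y (begin
  x + p      ≤⟨ +-monoʳ-≤ x p≤q ⟩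
  x + q      ≤⟨ m≤m+n (x + q) k ⟩
  x + q + k  ≡⟨ eq ⟩
  y + p      ∎)
  where open ≤-Reasoning

≤-slack : ∀ {x y} k → x + k ≡ y → x ≤ y
≤-slack {x} k eq = m+n≤o⇒m≤o x (≤-reflexive eq)

≰-by : ∀ {p q} k → p ≤ q → p ≡ suc (q + k) → ⊥
≰-by {q = q} k p≤q refl = <-irrefl refl (≤-trans p≤q (m≤m+n q k))

module Periodic {A : Set} (d : ℕ) (h : ℕ → A) (h-% : ∀ x → h (x % suc d) ≡ h x) where

  open ≡-Reasoning

  h-+k*period : ∀ x k → h (x + k * suc d) ≡ h x
  h-+k*period x k = begin
    h (x + k * suc d)             ≡⟨ h-% (x + k * suc d) ⟨
    h ((x + k * suc d) % suc d)   ≡⟨ cong h ([m+kn]%n≡m%n x k (suc d)) ⟩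
    h (x % suc d)                 ≡⟨ h-% x ⟩
    h x                           ∎

  h-+period : ∀ x → h (x + suc d) ≡ h x
  h-+period x = trans (cong (λ z → h (x + z)) (sym (*-identityˡ (suc d)))) (h-+k*period x 1)

  h-+% : ∀ x y → h (x + y % suc d) ≡ h (x + y)
  h-+% x y = begin
    h (x + y % suc d)                           ≡⟨ h-+k*period (x + y % suc d) (y / suc d) ⟨
    h (x + y % suc d + y / suc d * suc d)       ≡⟨ cong h (+-assoc x (y % suc d) _) ⟩
    h (x + (y % suc d + y / suc d * suc d))     ≡⟨ cong (λ z → h (x + z)) (m≡m%n+[m/n]*n y (suc d)) ⟨
    h (x + y)                                   ∎

  offset : ∀ x y → ∃[ j ] (j < suc d × h y ≡ h (x + j))
  -- Modulo `suc d`, the term `x * d` is -x; this avoids truncated subtraction.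
  offset x y = (y + x * d) % suc d , m%n<n (y + x * d) (suc d) , (begin
    h y                             ≡⟨ h-+k*period y x ⟨
    h (y + x * suc d)               ≡⟨ cong h rearrange ⟩
    h (x + (y + x * d))             ≡⟨ h-+% x (y + x * d) ⟨
    h (x + (y + x * d) % suc d)     ∎)
    where
    rearrange : y + x * suc d ≡ x + (y + x * d)
    rearrange = solve (x ∷ y ∷ d ∷ [])

-- The vertices of Γ (suc (suc m)) cut into the consecutive blocks
-- v, A, u, B, w, C of sizes 1, suc m, 1, m, 1 and suc m. Deleting v, u and w
-- leaves Γ (suc m).
data Position (m : ℕ) : ℕ → Set where
  at-v : Position m 0
  at-A : ∀ {i} → i ≤ m → Position m (suc i)
  at-u : Position m (suc (suc m + 0))
  at-B : ∀ {i} → i < m → Position m (suc (suc m + suc i))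
  at-w : Position m (suc (suc m + suc (m + 0)))
  at-C : ∀ i → Position m (suc (suc m + suc (m + suc i)))

position : ∀ m x → Position m x
position m zero = at-v
position m (suc x) with x ≤? m
... | yes x≤m = at-A x≤m
... | no x≰m with m≤n⇒∃[o]m+o≡n (≰⇒> x≰m)
...   | zero , refl = at-u
...   | suc y , refl with y <? m
...     | yes y<m = at-B y<m
...     | no y≮m with m≤n⇒∃[o]m+o≡n (≮⇒≥ y≮m)
...       | zero , refl = at-w
...       | suc i , refl = at-C i

-- Copies of Andrásfai graphs.

module Andrásfai {n : ℕ} (G : Graph (Fin n)) (adj? : Decidable (Adj G))
  (maximal : MaximalTriangleFree G) (noΥ : ¬ (Υ ⊑ G)) (D : PropertyD G adj? 3) where

  open Independent G adj? maximal noΥ D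

  isBlowUpOf : ∀ {W} (H : Graph W) (part : Fin n → W) (rep : W → Fin n) → (∀ w → part (rep w) ≡ w) →
    (∀ i j → Adj H i j → rep i ~ rep j) → (∀ i j → rep i ~ rep j → Adj H i j) →
    (∀ {x y} → x ~ y → rep (part x) ~ rep (part y)) →
    (∀ {x y} → rep (part x) ~ rep (part y) → x ~ y) →
    IsBlowUpOf G H
  isBlowUpOf H part rep part-rep H⇒~ ~⇒H ~⇒rep~ rep~⇒~ = record
    { part        = part
    ; nonEmpty    = λ w → rep w , part-rep w
    ; independent = λ eq x~y → Adj-irrefl G (cong rep eq) (~⇒rep~ x~y)
    ; complete    = λ e → rep~⇒~ (H⇒~ _ _ e)
    ; noFurther   = λ e → ~⇒H _ _ (~⇒rep~ e)
    }

  -- Γ (suc m) joins differences between m + 1 and 2m + 1, which is a range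
  -- invariant under d ↦ 3m + 2 − d; so it suffices to consider x < y.
  IsCopy : ℕ → (ℕ → Fin n) → Set
  IsCopy m g = ∀ {x y} → y < 2 + 3 * m → x + m < y → y ≤ suc (x + 2 * m) → g x ~ g y

  module PeriodicCopy (m : ℕ) (h : ℕ → Fin n) (h-% : ∀ x → h (x % (2 + 3 * m)) ≡ h x)
    (h-adj : ∀ {x y} → x + m < y → y ≤ suc (x + 2 * m) → h x ~ h y) where

    open Periodic (1 + 3 * m) h h-% using (h-+period; offset)

    -- The index `suc (x + 2 * m)` lies 2m + 1 beyond `x` and between m + 1 and 2m + 1 beyond `y`.
    close : ∀ {x y} → x ≤ y → y ≤ x + m →
      h (suc (x + 2 * m)) ~ h x × h (suc (x + 2 * m)) ~ h y
    close {x} {y} x≤y y≤x+m =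
      ~-sym (h-adj {x} {suc (x + 2 * m)} (≤-slack m (solve (x ∷ m ∷ []))) ≤-refl) ,
      ~-sym (h-adj {y} {suc (x + 2 * m)} (≤-by 0 y≤x+m (solve (x ∷ y ∷ m ∷ [])))
        (≤-by 0 x≤y (solve (x ∷ y ∷ m ∷ []))))

    close-≁ : ∀ {x y} → x ≤ y → y ≤ x + m → h x ≁ h y
    close-≁ x≤y y≤x+m = ≁-by _ (proj₁ (close x≤y y≤x+m)) (proj₂ (close x≤y y≤x+m))

    -- Offsets from m + 1 to 2m + 1 are edges. For the others one of the two arcs between the
    -- vertices has length at most m, so `close` applies.
    adj⊎common : ∀ x y → h x ~ h y ⊎ ∃[ z ] (h z ~ h x × h z ~ h y)
    adj⊎common x y with offset x y
    ... | j , j<N , hy≡ with j ≤? m | j ≤? suc (2 * m)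
    ...   | yes j≤m | _ with close (m≤m+n x j) (+-monoʳ-≤ x j≤m)
    ...     | e₁ , e₂ = inj₂ (_ , e₁ , subst (h _ ~_) (sym hy≡) e₂)
    adj⊎common x y | j , j<N , hy≡ | no j≰m | yes j≤2m+1 =
      inj₁ (subst (h x ~_) (sym hy≡) (h-adj {x} {x + j}
        (+-monoʳ-< x (≰⇒> j≰m)) (≤-by 0 j≤2m+1 (solve (x ∷ j ∷ m ∷ [])))))
    adj⊎common x y | j , j<N , hy≡ | no j≰m | no j≰2m+1
      with close {x + j} {x + (2 + 3 * m)} (+-monoʳ-≤ x (<⇒≤ j<N))
        (≤-by 0 (≰⇒> j≰2m+1) (solve (x ∷ j ∷ m ∷ [])))
    ... | e₁ , e₂ = inj₂ (_ , subst (h _ ~_) (h-+period x) e₂ , subst (h _ ~_) (sym hy≡) e₁)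

    separate-close : ∀ {x y} → x < y → y ≤ x + m → h x ~ h (suc (x + m)) × h y ≁ h (suc (x + m))
    separate-close {x} {y} x<y y≤x+m =
      h-adj {x} {suc (x + m)} ≤-refl (≤-slack m (solve (x ∷ m ∷ []))) ,
      close-≁ {y} {suc (x + m)} (m≤n⇒m≤1+n y≤x+m) (≤-by 0 x<y (solve (x ∷ y ∷ m ∷ [])))

    -- Andrásfai graphs have no twins. This makes a copy injective, which `IsCopy` does not demand,
    -- and later shows that each vertex of the copy represents itself.
    separate : ∀ {x y} → x < y → y < 2 + 3 * m →
      ∃[ z ] ((h x ~ h z × h y ≁ h z) ⊎ (h y ~ h z × h x ≁ h z))
    separate {x} {y} x<y y<N with y ≤? x + m | y ≤? suc (x + 2 * m)
    ... | yes y≤x+m | _          = suc (x + m) , inj₁ (separate-close x<y y≤x+m)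
    ... | no y≰x+m  | yes y≤2m+1 = y , inj₁ (h-adj (≰⇒> y≰x+m) y≤2m+1 , Adj-irrefl G refl)
    ... | no y≰x+m  | no y≰2m+1
      with separate-close {y} {x + (2 + 3 * m)} (≤-by x y<N (solve (x ∷ y ∷ m ∷ [])))
        (≤-by 0 (≰⇒> y≰2m+1) (solve (x ∷ y ∷ m ∷ [])))
    ...   | e , n = suc (y + m) , inj₂ (e , subst (_≁ h (suc (y + m))) (h-+period x) n)

    h≢h : ∀ {x y} → x < y → y < 2 + 3 * m → h x ≢ h y
    h≢h {x} {y} x<y y<N eq with separate x<y y<N
    ... | z , inj₁ (e , n) = n (subst (_~ h z) eq e)
    ... | z , inj₂ (e , n) = n (subst (_~ h z) (sym eq) e)

    N≤n : 2 + 3 * m ≤ n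
    N≤n = injective⇒≤ {f = h ∘ toℕ} inj
      where
      inj : ∀ {i j} → h (toℕ i) ≡ h (toℕ j) → i ≡ j
      inj {i} {j} eq with <-cmp (toℕ i) (toℕ j)
      ... | tri< i<j _ _ = contradiction eq (h≢h i<j (toℕ<n j))
      ... | tri≈ _ i≡j _ = toℕ-injective i≡j
      ... | tri> _ _ j<i = contradiction (sym eq) (h≢h j<i (toℕ<n i))

    IsClone : Fin n → Fin n → Set
    IsClone v w = ∀ y → (v ~ h y → w ~ h y) × (w ~ h y → v ~ h y)

    -- In the copy, `h (suc (r + 2 * m))` sees exactly the arc from `r` to `r + m`. Every index off
    -- this arc is joined to `r` or to `r + m`, so `v` has no other neighbours in the copy either.
    arc⇒clone : ∀ {v r} → (∀ {j} → j ≤ m → v ~ h (r + j)) → IsClone v (h (suc (r + 2 * m)))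
    arc⇒clone {v} {r} arc y with offset r y
    ... | j , j<N , hy≡ with j ≤? m | j ≤? suc (2 * m)
    ...   | yes j≤m | _ = (λ _ → subst (h _ ~_) (sym hy≡) (proj₂ (close (m≤m+n r j) (+-monoʳ-≤ r j≤m)))) ,
                          (λ _ → subst (v ~_) (sym hy≡) (arc j≤m))
    ...   | no j≰m | yes j≤2m+1 =
        (λ e → contradiction (subst (v ~_) hy≡ e) (λ e → ≁-by v (arc z≤n) e
                 (h-adj {r + 0} {r + j} (≤-by 0 (≰⇒> j≰m) (solve (r ∷ j ∷ m ∷ [])))
                   (≤-by 0 j≤2m+1 (solve (r ∷ j ∷ m ∷ [])))))) ,
        (λ e → contradiction (subst (h _ ~_) hy≡ e) (≁-sym (close-≁ {r + j} {suc (r + 2 * m)}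
                 (≤-by 0 j≤2m+1 (solve (r ∷ j ∷ m ∷ [])))
                 (≤-by 0 (≰⇒> j≰m) (solve (r ∷ j ∷ m ∷ []))))))
    ...   | no j≰m | no j≰2m+1 =
        (λ e → contradiction (subst (v ~_) hy≡ e) (λ e → ≁-by v (arc ≤-refl) e
                 (h-adj {r + m} {r + j} (≤-by 1 (≰⇒> j≰2m+1) (solve (r ∷ j ∷ m ∷ [])))
                   (≤-by 0 j<N (solve (r ∷ j ∷ m ∷ [])))))) ,
        (λ e → contradiction (subst (h _ ~_) hy≡ e) (close-≁ {suc (r + 2 * m)} {r + j}
                 (≤-by 1 (≰⇒> j≰2m+1) (solve (r ∷ j ∷ m ∷ [])))
                 (≤-by 0 j<N (solve (r ∷ j ∷ m ∷ [])))))

    lastWithin : ∀ {v x} k → v ~ h x →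
      ∃[ M ] (x ≤ M × M ≤ x + k × v ~ h M × (∀ {y} → M < y → y ≤ x + k → v ≁ h y))
    lastWithin {v} {x} zero v~hx = x , ≤-refl , m≤m+n x 0 , v~hx ,
      λ x<y y≤x+0 _ → <⇒≱ x<y (subst (_ ≤_) (+-identityʳ x) y≤x+0)
    lastWithin {v} {x} (suc k) v~hx with adj? v (h (x + suc k))
    ... | yes e = x + suc k , m≤m+n x (suc k) , ≤-refl , e , λ M<y y≤M _ → <⇒≱ M<y y≤M
    ... | no n with lastWithin k v~hx
    ...   | M , x≤M , M≤x+k , e , gap = M , x≤M , ≤-trans M≤x+k (+-monoʳ-≤ x (n≤1+n k)) , e , gap′
      where
      gap′ : ∀ {y} → M < y → y ≤ x + suc k → v ≁ h y
      gap′ {y} M<y y≤x+1+k with m≤n⇒m<n∨m≡n y≤x+1+k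
      ... | inj₁ y<x+1+k = gap M<y (≤-pred (subst (y <_) (+-suc x k) y<x+1+k))
      ... | inj₂ refl    = n

    -- As the period is 3m + 2, this confines the neighbours of `v` to the m + 1 indices ending at
    -- `M`.
    IsLast : Fin n → ℕ → Set
    IsLast v M = ∀ {y} → M < y → y ≤ suc (M + 2 * m) → v ≁ h y

    -- Take the last neighbour `M` between `x` and `x + m`. The following indices up to
    -- `suc (x + 2 * m)` are joined to `x`, and those from there to `suc (M + 2 * m)` are joined to
    -- `M`.
    lastNeighbour : ∀ {v x} → v ~ h x → ∃[ M ] (v ~ h M × IsLast v M)
    lastNeighbour {v} {x} v~hx with lastWithin m v~hx
    ... | M , x≤M , M≤x+m , v~hM , gap = M , v~hM , last
      where
      last : IsLast v M
      last {y} M<y y≤ with y ≤? x + m | y ≤? suc (x + 2 * m)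
      ... | yes y≤x+m | _        = gap M<y y≤x+m
      ... | no y≰x+m | yes y≤2m  = λ e → ≁-by v v~hx e (h-adj {x} {y} (≰⇒> y≰x+m) y≤2m)
      ... | no _     | no y≰2m   = λ e → ≁-by v v~hM e
        (h-adj {M} {y} (≤-by 1 (+-mono-≤ M≤x+m (≰⇒> y≰2m)) (solve (x ∷ y ∷ M ∷ m ∷ []))) y≤)

    neighbour⊎none : ∀ v → (∃[ x ] v ~ h x) ⊎ (∀ x → v ≁ h x)
    neighbour⊎none v with any? {n = 2 + 3 * m} (λ i → adj? v (h (toℕ i)))
    ... | yes (i , e) = inj₁ (toℕ i , e)
    ... | no none     = inj₂ λ x e → none (fromℕ< (m%n<n x (2 + 3 * m)) ,
      subst (v ~_) (sym (trans (cong h (toℕ-fromℕ< _)) (h-% x))) e)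

    -- One period from `p` on: m non-neighbours, an undecided position m, m neighbours, m + 1
    -- non-neighbours. Position m decides between a clone and a larger copy.
    record Arc (v : Fin n) (p : ℕ) : Set where
      field
        before : ∀ {j} → j < m → v ≁ h (p + j)
        middle : ∀ {j} → m < j → j ≤ 2 * m → v ~ h (p + j)
        after  : ∀ {j} → 2 * m < j → j ≤ 1 + 3 * m → v ≁ h (p + j)

    module _ {v M} (v~hM : v ~ h M) (last : IsLast v M) where

      arc-before : ∀ {j} → j < m → v ≁ h (2 + M + m + j)
      arc-before {j} j<m = last {2 + M + m + j} (≤-slack (suc (m + j)) (solve (M ∷ m ∷ j ∷ [])))
        (≤-by 0 j<m (solve (M ∷ m ∷ j ∷ [])))

      arc-after : ∀ {j} → 2 * m < j → j ≤ 1 + 3 * m → v ≁ h (2 + M + m + j)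
      arc-after 2m<j j≤ with m≤n⇒∃[o]m+o≡n 2m<j
      ... | t , refl = subst (v ≁_) (trans (sym (h-+period (1 + M + t))) (cong h rearrange))
        (last {1 + M + t} (s≤s (m≤m+n M t)) (≤-by m j≤ (solve (M ∷ m ∷ t ∷ []))))
        where
        rearrange : 1 + M + t + (2 + 3 * m) ≡ 2 + M + m + (suc (2 * m) + t)
        rearrange = solve (M ∷ m ∷ t ∷ [])

      -- The 5-cycle below has at most one vertex, its first, outside the
      -- interval from M + 1 to M + 2m + 1, where v has no neighbour.
      arc-middle : ∀ {j} → m < j → j ≤ 2 * m → v ~ h (2 + M + m + j)
      arc-middle m<j j≤2m with m≤n⇒m<n∨m≡n j≤2m
      ... | inj₂ refl = subst (v ~_) (trans (sym (h-+period M)) (cong h rearrange)) v~hM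
        where
        rearrange : M + (2 + 3 * m) ≡ 2 + M + m + 2 * m
        rearrange = solve (M ∷ m ∷ [])
      ... | inj₁ j<2m with m≤n⇒∃[o]m+o≡n m<j
      ...   | t , refl with pentagon-dominates v
        (~-sym (h-adj {2 + M + t} {2 + M + m + (suc m + t)} (≤-slack m (solve (M ∷ m ∷ t ∷ [])))
          (≤-slack 0 (solve (M ∷ m ∷ t ∷ [])))))
        (h-adj {2 + M + t} {suc (M + 2 * m)} (≤-by 0 j<2m (solve (M ∷ m ∷ t ∷ [])))
          (≤-slack (suc (suc t)) (solve (M ∷ m ∷ t ∷ []))))
        (~-sym (h-adj {1 + M} {suc (M + 2 * m)} (≤-by (suc t) j<2m (solve (M ∷ m ∷ t ∷ [])))
          (≤-slack 1 (solve (M ∷ m ∷ [])))))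
        (h-adj {1 + M} {2 + M + m + t} (≤-slack t (solve (M ∷ m ∷ t ∷ [])))
          (≤-by 2 j<2m (solve (M ∷ m ∷ t ∷ []))))
        (h-adj {2 + M + m + t} {2 + M + m + (suc m + t)} (≤-slack 0 (solve (M ∷ m ∷ t ∷ [])))
          (≤-slack m (solve (M ∷ m ∷ t ∷ []))))
      ...     | inj₁ e = e
      ...     | inj₂ (inj₁ e) = contradiction e
        (last {2 + M + t} (≤-slack (suc t) (solve (M ∷ m ∷ t ∷ [])))
          (≤-by (suc m) j<2m (solve (M ∷ m ∷ t ∷ []))))
      ...     | inj₂ (inj₂ (inj₁ e)) = contradiction e (last (s≤s (m≤m+n M (2 * m))) ≤-refl)
      ...     | inj₂ (inj₂ (inj₂ (inj₁ e))) = contradiction e (last ≤-refl (s≤s (m≤m+n M (2 * m))))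
      ...     | inj₂ (inj₂ (inj₂ (inj₂ e))) = contradiction e
        (last {2 + M + m + t} (≤-slack (suc (m + t)) (solve (M ∷ m ∷ t ∷ [])))
          (≤-by 1 j<2m (solve (M ∷ m ∷ t ∷ []))))

    someNeighbour : ∀ v → 1 ≤ m → ∃[ x ] v ~ h x
    -- The 5-cycle is 0, m + 1, 2m + 2, 3m + 3, m + 2, where 3m + 3 represents 1. Its last edge
    -- needs m ≥ 1.
    someNeighbour v 1≤m with pentagon-dominates v
      (h-adj {0} {suc m} ≤-refl (≤-slack m (solve (m ∷ []))))
      (h-adj {suc m} {2 + 2 * m} (≤-slack 0 (solve (m ∷ []))) (≤-slack m (solve (m ∷ []))))
      (h-adj {2 + 2 * m} {3 + 3 * m} (≤-slack 0 (solve (m ∷ []))) (≤-slack m (solve (m ∷ []))))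
      (~-sym (h-adj {2 + m} {3 + 3 * m} (≤-slack m (solve (m ∷ []))) (≤-slack 0 (solve (m ∷ [])))))
      (~-sym (h-adj {0} {2 + m} (≤-slack 1 (solve (m ∷ []))) (≤-by 0 1≤m (solve (m ∷ [])))))
    ... | inj₁ e                      = _ , e
    ... | inj₂ (inj₁ e)               = _ , e
    ... | inj₂ (inj₂ (inj₁ e))        = _ , e
    ... | inj₂ (inj₂ (inj₂ (inj₁ e))) = _ , e
    ... | inj₂ (inj₂ (inj₂ (inj₂ e))) = _ , e

    arc : ∀ v → ∃[ p ] Arc v p
    arc v with neighbour⊎none v
    ... | inj₁ (x , v~hx) with lastNeighbour v~hx
    ...   | M , v~hM , last = _ , record
      { before = arc-before v~hM last ; middle = arc-middle v~hM last ; after = arc-after v~hM last }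
    -- This occurs only for m = 0, when the range of `middle` is empty.
    arc v | inj₂ none = 0 , record
      { before = λ _ → none _
      ; middle = λ {j} m<j j≤2m → ⊥-elim (none _ (proj₂ (someNeighbour v
          (≤-by 0 (+-mono-≤ m<j j≤2m) (solve (j ∷ m ∷ []))))))
      ; after  = λ _ _ → none _
      }

    -- The blocks `A`, `B` and `C` hold the m + 1 non-neighbours from `p` on, the m neighbours and
    -- the last m + 1 non-neighbours. In the larger graph `v` must see `u`, `B`, `w`; moreover `u`
    -- must see `v` and `C`, and `w` must see `v` and `A`.
    module Extension {v p} (arc : Arc v p) (v≁hp+m : v ≁ h (p + m)) where

      open Arc arc

      common-after : ∃[ u ] (u ~ v × (∀ {i} → i < suc m → u ~ h (p + (suc (2 * m) + i))))
      common-after = common-applyUpTo v (λ i → h (p + (suc (2 * m) + i))) (suc m)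
        (λ {i} i≤m → after (m≤m+n (suc (2 * m)) i) (≤-by 0 i≤m (solve (i ∷ m ∷ []))))
        (λ {i} {j} i<j j≤m → close-≁ {p + (suc (2 * m) + i)} {p + (suc (2 * m) + j)}
          (≤-by 1 i<j (solve (p ∷ i ∷ j ∷ m ∷ []))) (≤-by i j≤m (solve (p ∷ i ∷ j ∷ m ∷ []))))

      common-before : ∃[ w ] (w ~ v × (∀ {i} → i < suc m → w ~ h (p + i)))
      common-before = common-applyUpTo v (λ i → h (p + i)) (suc m) v≁
        (λ {i} {j} i<j j≤m → close-≁ {p + i} {p + j}
          (≤-by 1 i<j (solve (p ∷ i ∷ j ∷ []))) (≤-by i j≤m (solve (p ∷ i ∷ j ∷ m ∷ []))))
        where
        v≁ : ∀ {i} → i < suc m → v ≁ h (p + i)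
        v≁ (s≤s i≤m) with m≤n⇒m<n∨m≡n i≤m
        ... | inj₁ i<m  = before i<m
        ... | inj₂ refl = v≁hp+m

      u w : Fin n
      u = proj₁ common-after
      w = proj₁ common-before

      place : ∀ {x} → Position m x → Fin n
      place at-v           = v
      place (at-A {i} _)   = h (p + i)
      place at-u           = u
      place (at-B {i} _)   = h (p + (suc m + i))
      place at-w           = w
      place (at-C i)       = h (p + (suc (2 * m) + i))

      -- Cases ending in `⊥-elim` are pairs of blocks whose indices cannot differ by m + 2 to 2m +
      -- 3. Between old blocks the difference shrinks by the number of inserted vertices, and the
      -- block sizes keep it between m + 1 and 2m + 1.
      place-~ : ∀ {x y} (P : Position m x) (Q : Position m y) → y < 2 + 3 * suc m →
        x + suc m < y → y ≤ suc (x + 2 * suc m) → place P ~ place Q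
      place-~ at-v at-v y< lo hi = ⊥-elim (≰-by (suc m) lo (solve (m ∷ [])))
      place-~ at-v (at-A {j} j≤m) y< lo hi = ⊥-elim (≰-by (0) (+-mono-≤ lo j≤m) (solve (j ∷ m ∷ [])))
      place-~ at-v at-u y< lo hi = ~-sym (proj₁ (proj₂ common-after))
      place-~ at-v (at-B {j} j<m) y< lo hi = middle (m≤m+n (suc m) j) (≤-by 0 j<m (solve (j ∷ m ∷ [])))
      place-~ at-v at-w y< lo hi = ~-sym (proj₁ (proj₂ common-before))
      place-~ at-v (at-C j) y< lo hi = ⊥-elim (≰-by (j) hi (solve (j ∷ m ∷ [])))
      place-~ (at-A {i} i≤m) at-v y< lo hi = ⊥-elim (≰-by (2 + i + m) lo (solve (i ∷ m ∷ [])))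
      place-~ (at-A {i} i≤m) (at-A {j} j≤m) y< lo hi = ⊥-elim (≰-by (1 + i) (+-mono-≤ lo j≤m) (solve (i ∷ j ∷ m ∷ [])))
      place-~ (at-A {i} i≤m) at-u y< lo hi = ⊥-elim (≰-by (i) lo (solve (i ∷ m ∷ [])))
      place-~ (at-A {i} i≤m) (at-B {j} j<m) y< lo hi = h-adj {p + i} {p + (suc m + j)}
        (≤-by 0 lo (solve (p ∷ i ∷ j ∷ m ∷ []))) (≤-by (1 + i) j<m (solve (p ∷ i ∷ j ∷ m ∷ [])))
      place-~ (at-A {i} i≤m) at-w y< lo hi = ~-sym (proj₂ (proj₂ common-before) (s≤s i≤m))
      place-~ (at-A {i} i≤m) (at-C j) y< lo hi = h-adj {p + i} {p + (suc (2 * m) + j)}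
        (≤-by j i≤m (solve (p ∷ i ∷ j ∷ m ∷ []))) (≤-by 0 hi (solve (p ∷ i ∷ j ∷ m ∷ [])))
      place-~ at-u at-v y< lo hi = ⊥-elim (≰-by (3 + 2 * m) lo (solve (m ∷ [])))
      place-~ at-u (at-A {j} j≤m) y< lo hi = ⊥-elim (≰-by (2 + m) (+-mono-≤ lo j≤m) (solve (j ∷ m ∷ [])))
      place-~ at-u at-u y< lo hi = ⊥-elim (≰-by (1 + m) lo (solve (m ∷ [])))
      place-~ at-u (at-B {j} j<m) y< lo hi = ⊥-elim (≰-by (1) (+-mono-≤ lo j<m) (solve (j ∷ m ∷ [])))
      place-~ at-u at-w y< lo hi = ⊥-elim (≰-by (0) lo (solve (m ∷ [])))
      place-~ at-u (at-C j) y< lo hi = proj₂ (proj₂ common-after) {j} (≤-by 0 y< (solve (j ∷ m ∷ [])))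
      place-~ (at-B {i} i<m) at-v y< lo hi = ⊥-elim (≰-by (4 + 2 * m + i) lo (solve (i ∷ m ∷ [])))
      place-~ (at-B {i} i<m) (at-A {j} j≤m) y< lo hi = ⊥-elim (≰-by (3 + m + i) (+-mono-≤ lo j≤m) (solve (i ∷ j ∷ m ∷ [])))
      place-~ (at-B {i} i<m) at-u y< lo hi = ⊥-elim (≰-by (2 + m + i) lo (solve (i ∷ m ∷ [])))
      place-~ (at-B {i} i<m) (at-B {j} j<m) y< lo hi = ⊥-elim (≰-by (2 + i) (+-mono-≤ lo j<m) (solve (i ∷ j ∷ m ∷ [])))
      place-~ (at-B {i} i<m) at-w y< lo hi = ⊥-elim (≰-by (1 + i) lo (solve (i ∷ m ∷ [])))
      place-~ (at-B {i} i<m) (at-C j) y< lo hi = h-adj {p + (suc m + i)} {p + (suc (2 * m) + j)}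
        (≤-by 0 lo (solve (p ∷ i ∷ j ∷ m ∷ []))) (≤-by (1 + i) y< (solve (p ∷ i ∷ j ∷ m ∷ [])))
      place-~ {y = y} at-w _ y< lo hi = ⊥-elim (≰-by (0) (+-mono-≤ lo y<) (solve (y ∷ m ∷ [])))
      place-~ {y = y} (at-C i) _ y< lo hi = ⊥-elim (≰-by (1 + i) (+-mono-≤ lo y<) (solve (i ∷ y ∷ m ∷ [])))

      extension : IsCopy (suc m) (place ∘ position m)
      extension {x} {y} = place-~ (position m x) (position m y)

    clone⊎larger : ∀ v → (∃[ s ] IsClone v (h s)) ⊎ (∃[ g ] IsCopy (suc m) g)
    clone⊎larger v with arc v
    ... | p , arc with adj? v (h (p + m))
    ...   | no n  = inj₂ (_ , Extension.extension arc n)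
    ...   | yes e = inj₁ (_ , arc⇒clone arc′)
      where
      arc′ : ∀ {j} → j ≤ m → v ~ h (p + m + j)
      arc′ {zero} _  = subst (λ z → v ~ h z) (sym (+-identityʳ (p + m))) e
      arc′ {suc j} j<m = subst (λ z → v ~ h z) (sym (+-assoc p m (suc j)))
        (Arc.middle arc {m + suc j} (m<m+n m (s≤s z≤n)) (≤-by 0 j<m (solve (j ∷ m ∷ []))))

    -- From clones to a blow-up.

    size : 3 * suc m ∸ 1 ≡ 2 + 3 * m
    size = eq
      where
      eq : m + (suc m + (suc m + 0)) ≡ 2 + 3 * m
      eq = solve (m ∷ [])

    Γ⇒~-≥ : ∀ i j → toℕ j ≤ toℕ i → Adj (Γ (suc m)) i j → h (toℕ j) ~ h (toℕ i)
    Γ⇒~-≥ i j j≤i (lo , hi) = subst (λ x → h (toℕ j) ~ h x) (sym i≡j+d)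
      (h-adj (+-monoʳ-< (toℕ j) lo) (upper (toℕ j) hi))
      where
      i≡j+d : toℕ i ≡ toℕ j + toℕ (i ⊖ j)
      i≡j+d = trans (sym (m+[n∸m]≡n j≤i)) (cong (toℕ j +_) (sym (toℕ-⊖-≥ i j j≤i)))
      upper : ∀ x {d} → d ≤ m + suc (m + 0) → x + d ≤ suc (x + 2 * m)
      upper x {d} d≤ = ≤-by 0 d≤ (solve (x ∷ d ∷ m ∷ []))

    Γ⇒~ : ∀ i j → Adj (Γ (suc m)) i j → h (toℕ i) ~ h (toℕ j)
    Γ⇒~ i j e with ≤-total (toℕ j) (toℕ i)
    ... | inj₁ j≤i = ~-sym (Γ⇒~-≥ i j j≤i e)
    ... | inj₂ i≤j = Γ⇒~-≥ j i i≤j (Adj-sym (Γ (suc m)) {i} {j} e)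

    distance : ∀ {x y} → x ≤ y → y < 2 + 3 * m → h x ~ h y → suc m ≤ y ∸ x × y ∸ x ≤ suc (2 * m)
    distance {x} x≤y y<N x~y with m≤n⇒∃[o]m+o≡n x≤y
    ... | d , refl rewrite m+n∸m≡n x d with d ≤? m | d ≤? suc (2 * m)
    ...   | yes d≤m | _        = contradiction x~y (close-≁ x≤y (+-monoʳ-≤ x d≤m))
    ...   | no d≰m  | yes d≤2m = ≰⇒> d≰m , d≤2m
    ...   | no _    | no d≰2m  = contradiction (~-sym x~y) (subst (h (x + d) ≁_) (h-+period x)
      (close-≁ {x + d} {x + (2 + 3 * m)} (≤-by (1 + x) y<N (solve (x ∷ d ∷ m ∷ [])))
        (≤-by 0 (≰⇒> d≰2m) (solve (x ∷ d ∷ m ∷ [])))))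

    ~⇒Γ-≥ : ∀ i j → toℕ j ≤ toℕ i → h (toℕ j) ~ h (toℕ i) → Adj (Γ (suc m)) i j
    ~⇒Γ-≥ i j j≤i e with distance j≤i (subst (toℕ i <_) size (toℕ<n i)) e
    ... | lo , hi = subst (suc m ≤_) (sym (toℕ-⊖-≥ i j j≤i)) lo ,
      subst (_≤ 2 * suc m ∸ 1) (sym (toℕ-⊖-≥ i j j≤i)) (≤-trans hi (≤-reflexive (sym (+-suc m (m + 0)))))

    ~⇒Γ : ∀ i j → h (toℕ i) ~ h (toℕ j) → Adj (Γ (suc m)) i j
    ~⇒Γ i j e with ≤-total (toℕ j) (toℕ i)
    ... | inj₁ j≤i = ~⇒Γ-≥ i j j≤i (~-sym e)
    ... | inj₂ i≤j = Adj-sym (Γ (suc m)) {j} {i} (~⇒Γ-≥ j i i≤j e)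

    vertex : ∀ s → ∃[ i ] h (toℕ {3 * suc m ∸ 1} i) ≡ h s
    vertex s = fromℕ< s%N<size , trans (cong h (toℕ-fromℕ< s%N<size)) (h-% s)
      where
      s%N<size : s % (2 + 3 * m) < 3 * suc m ∸ 1
      s%N<size = subst (s % (2 + 3 * m) <_) (sym size) (m%n<n s (2 + 3 * m))

    module BlowUp (part : Fin n → Fin (3 * suc m ∸ 1)) (part-clone : ∀ v → IsClone v (h (toℕ (part v)))) where

      rep : Fin n → Fin n
      rep v = h (toℕ (part v))

      rep-common⇒≁ : ∀ {x y} z → h z ~ rep x → h z ~ rep y → x ≁ y
      rep-common⇒≁ {x} {y} z zx zy =
        ≁-by (h z) (~-sym (proj₂ (part-clone x z) (~-sym zx))) (~-sym (proj₂ (part-clone y z) (~-sym zy)))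

      -- Non-adjacent representatives have a common neighbour in the copy; it is also adjacent to
      -- `x` and `y` and would form a triangle with them.
      ~⇒rep~ : ∀ {x y} → x ~ y → rep x ~ rep y
      ~⇒rep~ {x} {y} x~y with adj⊎common (toℕ (part x)) (toℕ (part y))
      ... | inj₁ e             = e
      ... | inj₂ (z , zx , zy) = contradiction x~y (rep-common⇒≁ z zx zy)

      -- By maximality, non-adjacent `x` and `y` have a common neighbour, whose representative would
      -- complete a triangle.
      rep~⇒~ : ∀ {x y} → rep x ~ rep y → x ~ y
      rep~⇒~ {x} {y} e with adj? x y
      ... | yes x~y = x~y
      ... | no x≁y with common₂ x≁y
      ...   | z , z~x , z~y = contradiction e (≁-by (rep z) (~⇒rep~ z~x) (~⇒rep~ z~y))

      h-notClone : ∀ {x y} → x < y → y < 2 + 3 * m → ¬ IsClone (h x) (h y)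
      h-notClone x<y y<N same with separate x<y y<N
      ... | z , inj₁ (xz , yz) = yz (proj₁ (same z) xz)
      ... | z , inj₂ (yz , xz) = xz (proj₂ (same z) yz)

      part-h : ∀ i → part (h (toℕ i)) ≡ i
      part-h i with <-cmp (toℕ (part (h (toℕ i)))) (toℕ i)
      ... | tri≈ _ eq _ = toℕ-injective eq
      ... | tri< lt _ _ = contradiction (λ y → proj₂ (part-clone (h (toℕ i)) y) , proj₁ (part-clone (h (toℕ i)) y))
        (h-notClone lt (subst (toℕ i <_) size (toℕ<n i)))
      ... | tri> _ _ gt = contradiction (part-clone (h (toℕ i)))
        (h-notClone gt (subst (toℕ (part (h (toℕ i))) <_) size (toℕ<n (part (h (toℕ i))))))

      blowUp : IsBlowUpOf G (Γ (suc m))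
      blowUp = isBlowUpOf (Γ (suc m)) part (h ∘ toℕ) part-h Γ⇒~ ~⇒Γ ~⇒rep~ rep~⇒~

    clones⇒blowUp : (∀ v → ∃[ s ] IsClone v (h s)) → IsBlowUpOf G (Γ (suc m))
    clones⇒blowUp clone = BlowUp.blowUp (λ v → proj₁ (vertex (proj₁ (clone v))))
      (λ v → subst (IsClone v) (sym (proj₂ (vertex (proj₁ (clone v))))) (proj₂ (clone v)))

    blowUp⊎larger : IsBlowUpOf G (Γ (suc m)) ⊎ ∃[ g ] IsCopy (suc m) g
    -- Sequencing over all vertices, with a larger copy as failure value: either all have clones or
    -- one enlarges the copy.
    blowUp⊎larger = map₁ clones⇒blowUp (sequence (applicative 0ℓ _) clone⊎larger)

  -- Periodic extension of a copy, and growth to a maximal one.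

  module Copy (m : ℕ) (g : ℕ → Fin n) (g-adj : IsCopy m g) where

    h : ℕ → Fin n
    h x = g (x % (2 + 3 * m))

    h-< : ∀ {x} → x < 2 + 3 * m → h x ≡ g x
    h-< x<N = cong g (m<n⇒m%n≡m x<N)

    h-% : ∀ x → h (x % (2 + 3 * m)) ≡ h x
    h-% x = cong g (m%n%n≡m%n x (2 + 3 * m))

    open Periodic (1 + 3 * m) h h-% using (h-+period; h-+%)

    -- If `y` passes the period, then `y = 2 + 3 * m + z` with x - z = 3m + 2 - (y - x), which lies
    -- in the same range.
    h-adj-< : ∀ {x y} → x < 2 + 3 * m → x + m < y → y ≤ suc (x + 2 * m) → h x ~ h y
    h-adj-< {x} {y} x<N lo hi with y <? 2 + 3 * m
    ... | yes y<N = subst₂ _~_ (sym (h-< x<N)) (sym (h-< y<N)) (g-adj y<N lo hi)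
    ... | no y≮N with m≤n⇒∃[o]m+o≡n (≮⇒≥ y≮N)
    ...   | z , refl = subst₂ _~_ (sym (h-< x<N)) (trans (sym (h-< z<N)) (trans (sym (h-+period z)) (cong h (+-comm z (2 + 3 * m)))))
        (~-sym (g-adj {z} {x} x<N
          (≤-by 0 hi (solve (x ∷ z ∷ m ∷ [])))
          (≤-by 0 lo (solve (x ∷ z ∷ m ∷ [])))))
      where
      z<N : z < 2 + 3 * m
      z<N = ≤-by (suc m) (+-mono-≤ hi x<N) (solve (x ∷ z ∷ m ∷ []))

    h-adj : ∀ {x y} → x + m < y → y ≤ suc (x + 2 * m) → h x ~ h y
    h-adj {x} {y} lo hi with m≤n⇒∃[o]m+o≡n lo
    ... | e , refl = subst₂ _~_ (h-% x) (begin
        h (suc (x % (2 + 3 * m) + m + e))    ≡⟨ cong h (reorder (x % (2 + 3 * m))) ⟩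
        h (suc (m + e) + x % (2 + 3 * m))    ≡⟨ h-+% (suc (m + e)) x ⟩
        h (suc (m + e) + x)                  ≡⟨ cong h (reorder x) ⟨
        h (suc (x + m + e))                  ∎)
        (h-adj-< (m%n<n x (2 + 3 * m)) (s≤s (m≤m+n (x % (2 + 3 * m) + m) e)) (widen (x % (2 + 3 * m))))
      where
      open ≡-Reasoning
      reorder : ∀ z → suc (z + m + e) ≡ suc (m + e) + z
      reorder z = solve (z ∷ m ∷ e ∷ [])
      widen : ∀ z → suc (z + m + e) ≤ suc (z + 2 * m)
      widen z = ≤-by 0 hi (solve (x ∷ z ∷ e ∷ m ∷ []))

    N≤n : 2 + 3 * m ≤ n
    N≤n = PeriodicCopy.N≤n m h h-% h-adj

    blowUp⊎larger : IsBlowUpOf G (Γ (suc m)) ⊎ ∃[ g′ ] IsCopy (suc m) g′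
    blowUp⊎larger = PeriodicCopy.blowUp⊎larger m h h-% h-adj

  -- A copy has 3m + 2 ≤ n distinct vertices, so m stays below `n` and `fuel` cannot run out.
  grow : ∀ fuel m g → IsCopy m g → n ≤ m + fuel → ∃[ k ] 1 ≤ k × IsBlowUpOf G (Γ k)
  grow zero m g copy n≤m+0 =
    ⊥-elim (≰-by (1 + 2 * m) (+-mono-≤ (Copy.N≤n m g copy) n≤m+0) (solve (n ∷ m ∷ [])))
  grow (suc fuel) m g copy n≤m+1+fuel =
    [ (λ blowUp → suc m , s≤s z≤n , blowUp)
    , (λ { (g′ , copy′) → grow fuel (suc m) g′ copy′ (subst (n ≤_) (+-suc m fuel) n≤m+1+fuel) })
    ]′ (Copy.blowUp⊎larger m g copy)

  -- Γ₁ is a single edge, so only the values at 0 and 1 matter.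
  edge : Fin n → ℕ → Fin n
  edge v zero    = v
  edge v (suc _) = proj₁ (neighbour v)

  edge-copy : ∀ v → IsCopy 0 (edge v)
  edge-copy v {zero}  {suc _} _ _ _ = ~-sym (proj₂ (neighbour v))
  edge-copy v {suc x} {suc y} (s≤s (s≤s z≤n)) (s≤s ()) _

theorem1p3 :
  (n : ℕ) .{{_ : NonZero n}} (G : Graph (Fin n)) (adj? : Decidable (Adj G)) →
  MaximalTriangleFree G →
  ¬ (Υ ⊑ G) →
  PropertyD G adj? 3 →
  ∃[ k ] 1 ≤ k × IsBlowUpOf G (Γ k)
theorem1p3 n G adj? maximal noΥ D =
  Andrásfai.grow G adj? maximal noΥ D n 0 _ (Andrásfai.edge-copy G adj? maximal noΥ D v) ≤-refl
  where
  v : Fin n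
  v = fromℕ< (>-nonZero⁻¹ n)
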